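{- Let $(P,r)$ be a finite graded poset of rank $n$ that is shellable, i.e. its order complex $\varDelta(P)$ is shellable. Then for every $0\le k\le n$ the complex $\varDelta^{(k)}(P)$ is shellable.
   Context: A finite poset $P$ is graded of rank $n\ge 0$ if every maximal chain has length $n$ (i.e. $n+1$ elements); its rank function $r$ satisfies $r(x)=0$ for $x$ minimal and $r(y)=r(x)+1$ if $y$ covers $x$. The order complex $\varDelta(P)$ is the abstract simplicial complex whose simplices are the chains of $P$, and $\varDelta^{(k)}(P)=\{(x_0<\cdots<x_l)\mid r(x_l)-r(x_0)\le k\}\subseteq\varDelta(P)$. A finite simplicial complex is pure of dimension $m$ if all its maximal simplices have dimension $m$. A finite simplicial complex $\varDelta$ is shellable if its maximal simplices can be linearly ordered $F_1,\dots,F_t$ so that for every $j=2,\dots,t$ the subcomplex $\bigl(\bigcup_{i=1}^{j-1}F_i\bigr)\cap F_j$ (where each $F_i$ is regarded as the complex of all its faces) is pure of dimension $\dim F_j-1$. The empty simplex is regarded as having dimension $-1$, so that the complex $\{\emptyset\}$ is pure of dimension $-1$. -}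

module Defs where

open import Data.Fin using (Fin; _<_; toℕ)
open import Data.Fin.Induction using (Acc; acc; po-wellFounded; po-noetherian)
open import Data.Fin.Properties using (any?)
open import Data.Fin.Subset using (Subset; _∈_; _⊆_; ∣_∣)
open import Data.Fin.Subset.Properties using (⊆-trans; _∈?_)
open import Data.Integer as ℤ using (ℤ; +_; 1ℤ)
open import Data.Nat as ℕ using (ℕ; suc; _∸_; _≤_)
import Data.Nat.Properties as ℕ
open import Data.Product using (Σ-syntax; ∃-syntax; _×_; _,_; proj₁)
open import Data.Sum using (_⊎_; inj₁; inj₂)
open import Function using (_⇔_; Injective)
open import Level using (0ℓ)
open import Relation.Binary using (Rel; IsDecPartialOrder)
import Relation.Binary.Construct.NonStrictToStrict as ToStrict
open import Relation.Binary.PropositionalEquality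
  using (_≡_; refl; sym; subst)
open import Relation.Nullary using (¬_; yes; no; contradiction)
open import Relation.Nullary.Decidable using (_×-dec_; ¬?)
open import Relation.Unary using (Pred)

-- A family of subsets of Fin N closed under taking faces.  The empty
-- simplex is treated like any other, so a complex with at least one
-- simplex contains it; the complex without simplices is allowed too, as
-- the value of an empty union.  Points of Fin N need not be vertices.

record SimplicialComplex (N : ℕ) : Set₁ where
  field
    Simplex     : Pred (Subset N) 0ℓ
    down-closed : ∀ {s t} → t ⊆ s → Simplex s → Simplex t

open SimplicialComplex public using (Simplex)

module _ {N : ℕ} where

  -- dim ∅ = -1
  dim : Subset N → ℤ
  dim s = + ∣ s ∣ ℤ.- 1ℤ

  IsMaximalSimplex : SimplicialComplex N → Subset N → Set
  IsMaximalSimplex K s = Simplex K s × (∀ t → Simplex K t → s ⊆ t → t ≡ s)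

  Pure : SimplicialComplex N → ℤ → Set
  Pure K m = ∀ s → IsMaximalSimplex K s → dim s ≡ m

  faces : Subset N → SimplicialComplex N
  faces s = record
    { Simplex     = λ t → t ⊆ s
    ; down-closed = ⊆-trans
    }

  ⋃ : {I : Set} → (I → SimplicialComplex N) → SimplicialComplex N
  ⋃ K = record
    { Simplex     = λ s → ∃[ i ] Simplex (K i) s
    ; down-closed = λ { t⊆s (i , p) →
        i , SimplicialComplex.down-closed (K i) t⊆s p }
    }

  infixr 7 _∩_
  _∩_ : SimplicialComplex N → SimplicialComplex N → SimplicialComplex N
  K ∩ L = record
    { Simplex     = λ s → Simplex K s × Simplex L s
    ; down-closed = λ { t⊆s (p , q) →
        SimplicialComplex.down-closed K t⊆s p ,
        SimplicialComplex.down-closed L t⊆s q }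
    }

  -- F enumerates the maximal simplices without repetition.  Indices start
  -- at zero, so the condition is imposed on all indices but the first.
  IsShelling : SimplicialComplex N → (t : ℕ) → (Fin t → Subset N) → Set
  IsShelling K t F =
    Injective _≡_ _≡_ F ×
    (∀ s → IsMaximalSimplex K s ⇔ (∃[ i ] F i ≡ s)) ×
    (∀ (j : Fin t) → 0 ℕ.< toℕ j →
       Pure (⋃ {I = Σ[ i ∈ Fin t ] i < j} (λ (i , _) → faces (F i)) ∩ faces (F j))
            (dim (F j) ℤ.- 1ℤ))

  Shellable : SimplicialComplex N → Set
  Shellable K = ∃[ t ] Σ[ F ∈ (Fin t → Subset N) ] IsShelling K t F

-- The decidability in IsDecPartialOrder holds classically for every order.

record FinitePoset (N : ℕ) : Set₁ where
  infix 4 _⊑_ _⊏_ _⋖_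
  field
    _⊑_               : Rel (Fin N) 0ℓ
    isDecPartialOrder : IsDecPartialOrder _≡_ _⊑_

  open IsDecPartialOrder isDecPartialOrder public
    using (isPartialOrder; antisym)
    renaming (refl to ⊑-refl; trans to ⊑-trans; _≟_ to _≟_; _≤?_ to _⊑?_)

  _⊏_ : Rel (Fin N) 0ℓ
  _⊏_ = ToStrict._<_ _≡_ _⊑_

  -- x ⋖ y : y covers x
  _⋖_ : Rel (Fin N) 0ℓ
  x ⋖ y = x ⊏ y × ¬ (∃[ z ] (x ⊏ z × z ⊏ y))

  IsMinimal : Pred (Fin N) 0ℓ
  IsMinimal x = ∀ y → y ⊑ x → y ≡ x

  IsChain : Pred (Subset N) 0ℓ
  IsChain s = ∀ {x y} → x ∈ s → y ∈ s → x ⊑ y ⊎ y ⊑ x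

  IsLeast : Subset N → Pred (Fin N) 0ℓ
  IsLeast s x = x ∈ s × (∀ {y} → y ∈ s → x ⊑ y)

  IsGreatest : Subset N → Pred (Fin N) 0ℓ
  IsGreatest s x = x ∈ s × (∀ {y} → y ∈ s → y ⊑ x)

  Δ : SimplicialComplex N
  Δ = record
    { Simplex     = IsChain
    ; down-closed = λ t⊆s c x∈t y∈t → c (t⊆s x∈t) (t⊆s y∈t)
    }

  private
    _⊏?_ : ∀ x y → _
    x ⊏? y = (x ⊑? y) ×-dec ¬? (x ≟ y)

  least : ∀ {s x} → IsChain s → x ∈ s → ∃[ y ] IsLeast s y
  least {s} c x∈s = go (po-wellFounded isPartialOrder _) x∈s
    where
    go : ∀ {x} → Acc _⊏_ x → x ∈ s → ∃[ y ] IsLeast s y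
    go {x} (acc rs) x∈s with any? (λ z → (z ∈? s) ×-dec (z ⊏? x))
    ... | yes (z , z∈s , z⊏x) = go (rs z⊏x) z∈s
    ... | no  none            = x , x∈s , below
      where
      below : ∀ {y} → y ∈ s → x ⊑ y
      below {y} y∈s with c x∈s y∈s | y ≟ x
      ... | inj₁ x⊑y | _        = x⊑y
      ... | inj₂ _   | yes refl = ⊑-refl
      ... | inj₂ y⊑x | no y≢x   = contradiction (y , y∈s , y⊑x , y≢x) none

  greatest : ∀ {s x} → IsChain s → x ∈ s → ∃[ y ] IsGreatest s y
  greatest {s} c x∈s = go (po-noetherian isPartialOrder _) x∈s
    where
    go : ∀ {x} → Acc (λ a b → b ⊏ a) x → x ∈ s → ∃[ y ] IsGreatest s y
    go {x} (acc rs) x∈s with any? (λ z → (z ∈? s) ×-dec (x ⊏? z))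
    ... | yes (z , z∈s , x⊏z) = go (rs x⊏z) z∈s
    ... | no  none            = x , x∈s , above
      where
      above : ∀ {y} → y ∈ s → y ⊑ x
      above {y} y∈s with c x∈s y∈s | x ≟ y
      ... | inj₂ y⊑x | _        = y⊑x
      ... | inj₁ _   | yes refl = ⊑-refl
      ... | inj₁ x⊑y | no x≢y   = contradiction (y , y∈s , x⊑y , x≢y) none

  module RankFunction
    (r       : Fin N → ℕ)
    (r-cover : ∀ {x y} → x ⋖ y → r y ≡ suc (r x))
    where

    r-mono : ∀ {x y} → x ⊑ y → r x ≤ r y
    r-mono = go (po-noetherian isPartialOrder _) (po-wellFounded isPartialOrder _)
      where
      go : ∀ {x y} → Acc (λ a b → b ⊏ a) x → Acc _⊏_ y → x ⊑ y → r x ≤ r y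
      go {x} {y} (acc up) (acc down) x⊑y with x ≟ y
      ... | yes refl = ℕ.≤-refl
      ... | no  x≢y with any? (λ z → (x ⊏? z) ×-dec (z ⊏? y))
      ...   | yes (z , x⊏z , z⊏y) =
                ℕ.≤-trans (go (acc up) (down z⊏y) (proj₁ x⊏z))
                          (go (up x⊏z) (acc down) (proj₁ z⊏y))
      ...   | no none =
                subst (r x ≤_) (sym (r-cover ((x⊑y , x≢y) , none))) (ℕ.n≤1+n _)

-- A poset on Fin N, graded of rank n, together with its rank function.

record GradedPoset (N n : ℕ) : Set₁ where
  field
    poset : FinitePoset N

  open FinitePoset poset public

  field
    maximal-chain : ∀ s → IsMaximalSimplex Δ s → ∣ s ∣ ≡ suc n
    r             : Fin N → ℕ
    r-minimal     : ∀ {x} → IsMinimal x → r x ≡ 0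
    r-cover       : ∀ {x y} → x ⋖ y → r y ≡ suc (r x)

  open RankFunction r r-cover public

  -- The condition says r x_l - r x_0 ≤ k for s = (x_0 < ⋯ < x_l) and is void
  -- for the empty chain; truncated subtraction is exact here by r-mono.
  Δ⟨_⟩ : ℕ → SimplicialComplex N
  Δ⟨ k ⟩ = record
    { Simplex     = λ s → IsChain s ×
        (∀ {x₀ xₗ} → IsLeast s x₀ → IsGreatest s xₗ → r xₗ ∸ r x₀ ≤ k)
    ; down-closed = λ { {s} {t} t⊆s (c , b) →
        (λ x∈t y∈t → c (t⊆s x∈t) (t⊆s y∈t)) ,
        λ { (x∈t , _) (y∈t , _) →
          let (_ , x₀∈s , lo) = least    {s} c (t⊆s x∈t)
              (_ , xₗ∈s , hi) = greatest {s} c (t⊆s y∈t)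
          in ℕ.≤-trans
               (ℕ.∸-mono (r-mono (hi (t⊆s y∈t))) (r-mono (lo (t⊆s x∈t))))
               (b (x₀∈s , lo) (xₗ∈s , hi)) } }
    }

module Submission where

-- A facet of Δ⟨ k ⟩ is a maximal chain of P cut down to a window of k + 1
-- consecutive ranks.  List the cuts F j ∩ [a , a + k] lexicographically in
-- (a , j), keeping first occurrences only, and use shellability in the form of
-- the exchange property: if G′ precedes G then some x ∈ G lies outside G′ and
-- G - x is contained in a predecessor of G.  If the window of G′ is lower, x is
-- the top of G, and lowering the window of the same F j by one contains G - x.
-- If the windows agree, exchange F j in the given shelling: when the element
-- exchanged lies outside the window, G is a repetition; otherwise restrict the
-- exchange to the window.

open import Defs
open import Data.Bool.Properties using () renaming (_≟_ to _≟ᵇ_)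
open import Data.Fin using (Fin; zero; suc; toℕ; fromℕ<; combine; _<_)
import Data.Fin as Fin
open import Data.Fin.Induction using (Acc; acc; po-wellFounded; <-wellFounded)
import Data.Fin.Properties as Fin
open import Data.Fin.Subset using (Subset; ⊥; inside; outside; ⁅_⁆; _∈_; _∉_; _⊆_; _⊃_; ∣_∣; _∪_; _-_)
open import Data.Fin.Subset.Induction using (⊃-wellFounded)
open import Data.Fin.Subset.Properties
open import Data.Integer as ℤ using (1ℤ)
import Data.Integer.Properties as ℤ
open import Data.Nat using (ℕ; zero; suc; _+_; _∸_; _≤_; z≤n; s≤s; _⊓_)
import Data.Nat as ℕ
import Data.Nat.Properties as ℕ
open import Data.Product using (Σ-syntax; ∃-syntax; ∃₂; _×_; _,_; proj₁; proj₂)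
open import Data.Sum using (_⊎_; inj₁; inj₂; swap)
open import Data.Vec using (_∷_; here; there; tabulate)
open import Data.Vec.Properties using (lookup∘tabulate; lookup⇒[]=; []=⇒lookup; ≡-dec)
open import Function using (_∘_; _⇔_; mk⇔; Equivalence)
open import Level using (0ℓ)
open import Relation.Binary using (tri<; tri≈; tri>)
open import Relation.Binary.PropositionalEquality using (_≡_; _≢_; refl; sym; trans; cong; subst; subst₂)
open import Relation.Nullary using (¬_; Dec; does; yes; no; contradiction)
open import Relation.Nullary.Decidable using (_×-dec_; _⊎-dec_; _→-dec_; ¬?; map′; dec-true)
open import Relation.Unary using (Pred; Decidable)

-- Finite subsets: comprehension, deletion, counting, maximal simplices

module _ {N : ℕ} where

  ⟪_⟫ : {Q : Pred (Fin N) 0ℓ} → Decidable Q → Subset N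
  ⟪ Q? ⟫ = tabulate (does ∘ Q?)

  ∈⟪⟫⁺ : ∀ {Q} (Q? : Decidable Q) {x} → Q x → x ∈ ⟪ Q? ⟫
  ∈⟪⟫⁺ Q? {x} q = lookup⇒[]= x _ (trans (lookup∘tabulate _ x) (dec-true (Q? x) q))

  ∈⟪⟫⁻ : ∀ {Q} (Q? : Decidable Q) {x} → x ∈ ⟪ Q? ⟫ → Q x
  ∈⟪⟫⁻ Q? {x} x∈ with Q? x in eq
  ... | yes q = q
  ... | no ¬q with () ← trans (sym ([]=⇒lookup x∈))
                        (trans (lookup∘tabulate _ x) (cong does eq))

x∉p-x : ∀ {N} {p : Subset N} {x} → x ∉ p - x
x∉p-x {p = _ ∷ p} {suc x} (there x∈) = x∉p-x {p = p} x∈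

∣p∣≡1+∣p-x∣ : ∀ {N} {p : Subset N} {x} → x ∈ p → ∣ p ∣ ≡ suc ∣ p - x ∣
∣p∣≡1+∣p-x∣ {p = _ ∷ p} here = cong (suc ∘ ∣_∣) (sym (p─⊥≡p p))
∣p∣≡1+∣p-x∣ {p = inside  ∷ p} (there x∈p) = cong suc (∣p∣≡1+∣p-x∣ x∈p)
∣p∣≡1+∣p-x∣ {p = outside ∷ p} (there x∈p) = ∣p∣≡1+∣p-x∣ x∈p

module _ {N : ℕ} where

  p-x⊆p : ∀ (p : Subset N) {x} → p - x ⊆ p
  p-x⊆p p = p─q⊆p p _

  ⊆-∣∣≤⇒⊇ : ∀ {p q : Subset N} → p ⊆ q → ∣ q ∣ ≤ ∣ p ∣ → q ⊆ p
  ⊆-∣∣≤⇒⊇ {p} p⊆q ∣q∣≤∣p∣ {x} x∈q with x ∈? p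
  ... | yes x∈p = x∈p
  ... | no  x∉p =
    contradiction (p⊂q⇒∣p∣<∣q∣ (p⊆q , x , x∈q , x∉p)) (ℕ.≤⇒≯ ∣q∣≤∣p∣)

  ∣∣<⇒∃∉ : ∀ {p q : Subset N} → ∣ p ∣ ℕ.< ∣ q ∣ → ∃[ x ] (x ∈ q × x ∉ p)
  ∣∣<⇒∃∉ {p} {q} ∣p∣<∣q∣ with Fin.any? (λ x → (x ∈? q) ×-dec ¬? (x ∈? p))
  ... | yes found = found
  ... | no  none  = contradiction (p⊆q⇒∣p∣≤∣q∣ q⊆p) (ℕ.<⇒≱ ∣p∣<∣q∣)
    where
    q⊆p : q ⊆ p
    q⊆p {x} x∈q with x ∈? p
    ... | yes x∈p = x∈p
    ... | no  x∉p = contradiction (x , x∈q , x∉p) none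

  -- A point of the top rank can be deleted without losing any smaller rank, so induction counts one
  -- point per rank.
  attained⇒≤∣∣ : (r : Fin N → ℕ) → ∀ b {s} →
    (∀ {m} → m ℕ.< b → ∃[ x ] (x ∈ s × r x ≡ m)) → b ≤ ∣ s ∣
  attained⇒≤∣∣ r zero    att = z≤n
  attained⇒≤∣∣ r (suc b) {s} att with att (ℕ.n<1+n b)
  ... | y , y∈s , ry≡b = subst (suc b ≤_) (sym (∣p∣≡1+∣p-x∣ y∈s))
        (s≤s (attained⇒≤∣∣ r b att′))
    where
    att′ : ∀ {m} → m ℕ.< b → ∃[ x ] (x ∈ s - y × r x ≡ m)
    att′ m<b with att (ℕ.m<n⇒m<1+n m<b)
    ... | x , x∈s , refl =
      x , x∈p∧x≢y⇒x∈p-y x∈s (λ x≡y → ℕ.<⇒≢ m<b (trans (cong r x≡y) ry≡b)) , refl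

  -- At most one point has the largest allowed value; deleting it, if present, lowers the bound by
  -- one.
  injective⇒∣∣≤ : (r : Fin N → ℕ) → ∀ b {s} →
    (∀ {x y} → x ∈ s → y ∈ s → r x ≡ r y → x ≡ y) →
    (∀ {x} → x ∈ s → r x ℕ.< b) → ∣ s ∣ ≤ b
  injective⇒∣∣≤ r zero {s} inj r<0 = ℕ.≮⇒≥ λ 0<∣s∣ →
    let x , x∈s , _ = ∣∣<⇒∃∉ {⊥} {s} (subst (ℕ._< ∣ s ∣) (sym (∣⊥∣≡0 N)) 0<∣s∣)
    in ℕ.n≮0 (r<0 x∈s)
  injective⇒∣∣≤ r (suc b) {s} inj r≤b with Fin.any? (λ y → (y ∈? s) ×-dec (r y ℕ.≟ b))
  ... | yes (y , y∈s , ry≡b) = subst (_≤ suc b) (sym (∣p∣≡1+∣p-x∣ y∈s))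
        (s≤s (injective⇒∣∣≤ r b
          (λ x∈ z∈ → inj (p-x⊆p s x∈) (p-x⊆p s z∈))
          (λ x∈ → ℕ.≤∧≢⇒< (ℕ.≤-pred (r≤b (p-x⊆p s x∈)))
            λ rx≡b → x∉p-x {p = s}
              (subst (_∈ s - y) (inj (p-x⊆p s x∈) y∈s (trans rx≡b (sym ry≡b))) x∈))))
  ... | no none = ℕ.m≤n⇒m≤1+n (injective⇒∣∣≤ r b inj
        (λ x∈s → ℕ.≤∧≢⇒< (ℕ.≤-pred (r≤b x∈s)) λ eq → none (_ , x∈s , eq)))

  _≟ˢ_ : (p q : Subset N) → Dec (p ≡ q)
  _≟ˢ_ = ≡-dec _≟ᵇ_

  -- Points are added one at a time. Once none can be added, a larger simplex with a new point `x`
  -- would have `s ∪ ⁅ x ⁆` as a face, a contradiction.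
  extend-to-maximal : (K : SimplicialComplex N) → Decidable (Simplex K) →
    ∀ {s} → Simplex K s → ∃[ t ] (IsMaximalSimplex K t × s ⊆ t)
  extend-to-maximal K K? = go (⊃-wellFounded _)
    where
    go : ∀ {s} → Acc _⊃_ s → Simplex K s → ∃[ t ] (IsMaximalSimplex K t × s ⊆ t)
    go {s} (acc rs) Ks with Fin.any? (λ x → ¬? (x ∈? s) ×-dec K? (s ∪ ⁅ x ⁆))
    ... | yes (x , x∉s , Ksx) =
          let t , t-max , sx⊆t = go (rs (p⊆p∪q _ , x , x∈p∪q⁺ (inj₂ (x∈⁅x⁆ x)) , x∉s)) Ksx
          in t , t-max , λ x∈s → sx⊆t (p⊆p∪q _ x∈s)
    ... | no none = s , (Ks , λ u Ku s⊆u → ⊆-antisym (u⊆s u Ku s⊆u) s⊆u) , λ x → x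
      where
      u⊆s : ∀ u → Simplex K u → s ⊆ u → u ⊆ s
      u⊆s u Ku s⊆u {x} x∈u with x ∈? s
      ... | yes x∈s = x∈s
      ... | no  x∉s = contradiction (x , x∉s , SimplicialComplex.down-closed K sx⊆u Ku) none
        where
        sx⊆u : s ∪ ⁅ x ⁆ ⊆ u
        sx⊆u y∈ with x∈p∪q⁻ s ⁅ x ⁆ y∈
        ... | inj₁ y∈s = s⊆u y∈s
        ... | inj₂ y∈x with refl ← x∈⁅y⁆⇒x≡y x y∈x = x∈u

dim≡dim-1⇒ : ∀ a b → ℤ.+ a ℤ.- 1ℤ ≡ (ℤ.+ b ℤ.- 1ℤ) ℤ.- 1ℤ → b ≡ suc a
dim≡dim-1⇒ zero    (suc zero)    eq = refl
dim≡dim-1⇒ (suc a) (suc (suc b)) eq = cong (2 +_) (ℤ.+-injective (sym eq))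

dim≡dim-1⇐ : ∀ a b → b ≡ suc a → ℤ.+ a ℤ.- 1ℤ ≡ (ℤ.+ b ℤ.- 1ℤ) ℤ.- 1ℤ
dim≡dim-1⇐ a _ refl = refl

m∸n≤o⇒m≤n+o : ∀ m n {o} → m ∸ n ≤ o → m ≤ n + o
m∸n≤o⇒m≤n+o m n m∸n≤o = ℕ.≤-trans (ℕ.m≤n+m∸n m n) (ℕ.+-monoʳ-≤ n m∸n≤o)

-- The shelling condition as an exchange property

module _ {N t : ℕ} where

  Exchange : (Fin t → Subset N) → Fin t → Fin t → Set
  Exchange F i j = ∃₂ λ x l → x ∈ F j × x ∉ F i × l < j × F j - x ⊆ F l

  earlier : (Fin t → Subset N) → Fin t → SimplicialComplex N
  earlier F j = ⋃ {I = Σ[ i ∈ Fin t ] i < j} (λ (i , _) → faces (F i)) ∩ faces (F j)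

  -- The intersection of `F i` and `F j` lies in a maximal simplex `s` of `earlier F j`. Purity
  -- makes `s` one point smaller than `F j`; that point is `x`, and `l` indexes an earlier set
  -- containing `s`.
  pure⇒exchange : ∀ (F : Fin t → Subset N) {i j} →
    Pure (earlier F j) (dim (F j) ℤ.- 1ℤ) → i < j → Exchange F i j
  pure⇒exchange F {i} {j} pure i<j = x , l , x∈Fj , x∉Fi , l<j , s⊆Fl ∘ Fj-x⊆s
    where
    earlier? : Decidable (Simplex (earlier F j))
    earlier? u with Fin.any? (λ i → (i Fin.<? j) ×-dec (u ⊆? F i)) | u ⊆? F j
    ... | yes (i , i<j , u⊆Fi) | yes u⊆Fj = yes (((i , i<j) , u⊆Fi) , u⊆Fj)
    ... | no  none             | _        = no λ (((i , i<j) , u⊆Fi) , _) → none (i , i<j , u⊆Fi)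
    ... | _                    | no u⊈Fj  = no λ (_ , u⊆Fj) → u⊈Fj u⊆Fj

    both? : Decidable (λ x → x ∈ F i × x ∈ F j)
    both? x = (x ∈? F i) ×-dec (x ∈? F j)

    ext = extend-to-maximal (earlier F j) earlier? {⟪ both? ⟫}
      (((i , i<j) , proj₁ ∘ ∈⟪⟫⁻ both?) , proj₂ ∘ ∈⟪⟫⁻ both?)
    s     = proj₁ ext
    s-max = proj₁ (proj₂ ext)
    ∩⊆s   = proj₂ (proj₂ ext)
    l     = proj₁ (proj₁ (proj₁ (proj₁ s-max)))
    l<j   = proj₂ (proj₁ (proj₁ (proj₁ s-max)))

    s⊆Fl : s ⊆ F l
    s⊆Fl = proj₂ (proj₁ (proj₁ s-max))

    s⊆Fj : s ⊆ F j
    s⊆Fj = proj₂ (proj₁ s-max)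

    ∣Fj∣≡1+∣s∣ : ∣ F j ∣ ≡ suc ∣ s ∣
    ∣Fj∣≡1+∣s∣ = dim≡dim-1⇒ ∣ s ∣ ∣ F j ∣ (pure s s-max)

    missing = ∣∣<⇒∃∉ {p = s} {F j} (ℕ.≤-reflexive (sym ∣Fj∣≡1+∣s∣))
    x    = proj₁ missing
    x∈Fj = proj₁ (proj₂ missing)
    x∉s  = proj₂ (proj₂ missing)

    x∉Fi : x ∉ F i
    x∉Fi x∈Fi = x∉s (∩⊆s (∈⟪⟫⁺ both? (x∈Fi , x∈Fj)))

    -- `s` avoids `x`, so it lies in `F j - x`; equal sizes force the reverse inclusion.
    Fj-x⊆s : F j - x ⊆ s
    Fj-x⊆s = ⊆-∣∣≤⇒⊇
      (λ {y} y∈s → x∈p∧x≢y⇒x∈p-y (s⊆Fj y∈s) (λ y≡x → x∉s (subst (_∈ s) y≡x y∈s)))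
      (ℕ.≤-reflexive (ℕ.suc-injective (trans (sym (∣p∣≡1+∣p-x∣ x∈Fj)) ∣Fj∣≡1+∣s∣)))

  -- A maximal `s` lies in both `F j` and some `F i`, so it misses the exchanged `x`. Thus
  -- `s ⊆ F j - x`, which is itself a simplex of `earlier F j`, and maximality gives equality.
  exchange⇒pure : ∀ (F : Fin t → Subset N) {j} → (∀ {i} → i < j → Exchange F i j) →
    Pure (earlier F j) (dim (F j) ℤ.- 1ℤ)
  exchange⇒pure F {j} exch s ((((i , i<j) , s⊆Fi) , s⊆Fj) , s-max) with exch i<j
  ... | x , l , x∈Fj , x∉Fi , l<j , Fj-x⊆Fl =
    dim≡dim-1⇐ ∣ s ∣ ∣ F j ∣ (subst (λ u → ∣ F j ∣ ≡ suc ∣ u ∣) Fj-x≡s (∣p∣≡1+∣p-x∣ x∈Fj))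
    where
    Fj-x≡s : F j - x ≡ s
    Fj-x≡s = s-max (F j - x) (((l , l<j) , Fj-x⊆Fl) , p-x⊆p (F j))
      λ y∈s → x∈p∧x≢y⇒x∈p-y (s⊆Fj y∈s) λ { refl → x∉Fi (s⊆Fi y∈s) }

-- Discarding repeated facets

enumerate : ∀ {m} {Q : Pred (Fin m) 0ℓ} → Decidable Q →
  ∃[ t ] Σ[ e ∈ (Fin t → Fin m) ]
    (∀ {i j} → i < j → e i < e j) × (∀ i → Q (e i)) × (∀ p → Q p → ∃[ i ] e i ≡ p)
enumerate {zero} Q? = 0 , (λ ()) , (λ { {()} }) , (λ ()) , (λ ())
enumerate {suc m} {Q} Q? with enumerate (Q? ∘ suc) | Q? zero
... | t , e , e-mono , Qe , e-onto | no ¬q₀ =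
      t , suc ∘ e , s≤s ∘ e-mono , Qe , onto
  where
  onto : ∀ p → Q p → ∃[ i ] suc (e i) ≡ p
  onto zero    q = contradiction q ¬q₀
  onto (suc p) q = let i , eq = e-onto p q in i , cong suc eq
... | t , e , e-mono , Qe , e-onto | yes q₀ = suc t , e′ , mono , Qe′ , onto
  where
  e′ : Fin (suc t) → Fin (suc m)
  e′ zero    = zero
  e′ (suc i) = suc (e i)

  mono : ∀ {i j} → i < j → e′ i < e′ j
  mono {zero}  {suc j} _         = s≤s z≤n
  mono {suc i} {suc j} (s≤s i<j) = s≤s (e-mono i<j)

  Qe′ : ∀ i → Q (e′ i)
  Qe′ zero    = q₀
  Qe′ (suc i) = Qe i

  onto : ∀ p → Q p → ∃[ i ] e′ i ≡ p
  onto zero    q = zero , refl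
  onto (suc p) q = let i , eq = e-onto p q in suc i , cong suc eq

module _ {N m : ℕ} (G : Fin m → Subset N) where

  Repeated : Fin m → Set
  Repeated j = ∃[ l ] (l < j × G l ≡ G j)

  repeated? : Decidable Repeated
  repeated? j = Fin.any? λ l → (l Fin.<? j) ×-dec (G l ≟ˢ G j)

  first-occurrence : ∀ j → ∃[ l ] (l Fin.≤ j × ¬ Repeated l × G l ≡ G j)
  first-occurrence j = go (<-wellFounded j)
    where
    go : ∀ {j} → Acc _<_ j → ∃[ l ] (l Fin.≤ j × ¬ Repeated l × G l ≡ G j)
    go {j} (acc rs) with repeated? j
    ... | no  new = j , ℕ.≤-refl , new , refl
    ... | yes (i , i<j , Gi≡Gj) =
          let l , l≤i , new , Gl≡Gi = go (rs i<j)
          in l , ℕ.≤-trans l≤i (ℕ.<⇒≤ i<j) , new , trans Gl≡Gi Gi≡Gj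

  -- Keeping first occurrences only does not change the set of facets. The exchange index `l` may be
  -- dropped, but its first occurrence is the same set at an index no later, so it serves instead.
  exchange⇒shellable : (K : SimplicialComplex N) →
    (∀ s → IsMaximalSimplex K s ⇔ (∃[ i ] G i ≡ s)) →
    (∀ {i j} → i < j → Repeated j ⊎ Exchange G i j) → Shellable K
  exchange⇒shellable K facets exch with enumerate (¬? ∘ repeated?)
  ... | t , e , e-mono , e-new , e-onto =
    t , G ∘ e , injective , facets′ , λ j _ → exchange⇒pure (G ∘ e) exch′
    where
    e-reflects-< : ∀ {p q} → e p < e q → p < q
    e-reflects-< {p} {q} ep<eq with Fin.<-cmp p q
    ... | tri< p<q _ _    = p<q
    ... | tri≈ _ refl _   = contradiction ep<eq (ℕ.<-irrefl refl)
    ... | tri> _ _ q<p    = contradiction ep<eq (ℕ.<-asym (e-mono q<p))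

    injective : ∀ {p q} → G (e p) ≡ G (e q) → p ≡ q
    injective {p} {q} eq with Fin.<-cmp p q
    ... | tri< p<q _ _ = contradiction (e p , e-mono p<q , eq) (e-new q)
    ... | tri≈ _ p≡q _ = p≡q
    ... | tri> _ _ q<p = contradiction (e q , e-mono q<p , sym eq) (e-new p)

    facets′ : ∀ s → IsMaximalSimplex K s ⇔ (∃[ p ] G (e p) ≡ s)
    facets′ s = mk⇔ to (λ (p , eq) → Equivalence.from (facets s) (e p , eq))
      where
      to : IsMaximalSimplex K s → ∃[ p ] G (e p) ≡ s
      to s-max with Equivalence.to (facets s) s-max
      ... | j , refl with first-occurrence j
      ...   | l , _ , new , Gl≡Gj with e-onto l new
      ...     | p , refl = p , Gl≡Gj

    exch′ : ∀ {p q} → p < q → Exchange (G ∘ e) p q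
    exch′ {p} {q} p<q with exch (e-mono p<q)
    ... | inj₁ rep = contradiction rep (e-new q)
    ... | inj₂ (x , l , x∈ , x∉ , l<eq , sub) with first-occurrence l
    ...   | l′ , l′≤l , new , Gl′≡Gl with e-onto l′ new
    ...     | p′ , refl =
      x , p′ , x∈ , x∉ , e-reflects-< (ℕ.≤-<-trans l′≤l l<eq) ,
      λ {y} y∈ → subst (y ∈_) (sym Gl′≡Gl) (sub y∈)

-- Maximal chains of a graded poset and their windows

module _ {N n : ℕ} (P : GradedPoset N n) where
  open GradedPoset P

  _⊏?_ : ∀ x y → Dec (x ⊏ y)
  x ⊏? y = (x ⊑? y) ×-dec ¬? (x ≟ y)

  isChain? : ∀ s → Dec (IsChain s)
  isChain? s = map′ (λ c x∈s y∈s → c _ _ x∈s y∈s) (λ c _ _ x∈s y∈s → c x∈s y∈s)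
    (Fin.all? λ x → Fin.all? λ y →
      (x ∈? s) →-dec (y ∈? s) →-dec ((x ⊑? y) ⊎-dec (y ⊑? x)))

  ⊏-⊑-trans : ∀ {x y z} → x ⊏ y → y ⊑ z → x ⊏ z
  ⊏-⊑-trans (x⊑y , x≢y) y⊑z = ⊑-trans x⊑y y⊑z , λ { refl → x≢y (antisym x⊑y y⊑z) }

  r-strict : ∀ {x y} → x ⊏ y → r x ℕ.< r y
  r-strict = go (po-wellFounded isPartialOrder _)
    where
    go : ∀ {x y} → Acc _⊏_ y → x ⊏ y → r x ℕ.< r y
    go {x} {y} (acc rs) x⊏y with Fin.any? (λ z → (x ⊏? z) ×-dec (z ⊏? y))
    ... | yes (z , x⊏z , z⊏y) = ℕ.<-≤-trans (go (rs z⊏y) x⊏z) (r-mono (proj₁ z⊏y))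
    ... | no  none            = ℕ.≤-reflexive (sym (r-cover (x⊏y , none)))

  r-injective : ∀ {s x y} → IsChain s → x ∈ s → y ∈ s → r x ≡ r y → x ≡ y
  r-injective {x = x} {y} c x∈s y∈s rx≡ry with x ≟ y | c x∈s y∈s
  ... | yes x≡y | _        = x≡y
  ... | no  x≢y | inj₁ x⊑y = contradiction rx≡ry (ℕ.<⇒≢ (r-strict (x⊑y , x≢y)))
  ... | no  x≢y | inj₂ y⊑x = contradiction (sym rx≡ry) (ℕ.<⇒≢ (r-strict (y⊑x , x≢y ∘ sym)))

  -- Adjoining `w` leaves `s` a chain, so maximality puts `w` in `s` already.
  comparable⇒∈ : ∀ {s w} → IsMaximalSimplex Δ s →
    (∀ {y} → y ∈ s → y ⊑ w ⊎ w ⊑ y) → w ∈ s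
  comparable⇒∈ {s} {w} (c , s-max) comp =
    subst (w ∈_) (s-max (s ∪ ⁅ w ⁆) chain (p⊆p∪q _)) (x∈p∪q⁺ (inj₂ (x∈⁅x⁆ w)))
    where
    chain : IsChain (s ∪ ⁅ w ⁆)
    chain x∈ y∈ with x∈p∪q⁻ s ⁅ w ⁆ x∈ | x∈p∪q⁻ s ⁅ w ⁆ y∈
    ... | inj₁ x∈s | inj₁ y∈s = c x∈s y∈s
    ... | inj₁ x∈s | inj₂ y∈w with refl ← x∈⁅y⁆⇒x≡y w y∈w = comp x∈s
    ... | inj₂ x∈w | inj₁ y∈s with refl ← x∈⁅y⁆⇒x≡y w x∈w = swap (comp y∈s)
    ... | inj₂ x∈w | inj₂ y∈w with refl ← x∈⁅y⁆⇒x≡y w x∈w | refl ← x∈⁅y⁆⇒x≡y w y∈w = inj₁ ⊑-refl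

  below? : ∀ s y → Decidable (λ x → x ∈ s × x ⊏ y)
  below? s y x = (x ∈? s) ×-dec (x ⊏? y)

  -- The largest element `x` of `s` below `y` is covered by `y`: a point strictly between would be
  -- comparable with all of `s`, hence in `s` and below `x`.
  predecessor : ∀ {s y m} → IsMaximalSimplex Δ s → y ∈ s → r y ≡ suc m →
    ∃[ x ] (x ∈ s × r x ≡ m)
  predecessor {s} {y} s-max@(c , _) y∈s ry≡1+m with Fin.any? (below? s y)
  -- With nothing of `s` below it, `y` is least in `s`. Any `z ⊑ y` is then below all of `s`, hence
  -- in `s`, so `y` is minimal in the poset and has rank zero.
  ... | no none = contradiction (trans (sym (r-minimal y-minimal)) ry≡1+m) λ ()
    where
    y-least : ∀ {x} → x ∈ s → y ⊑ x
    y-least {x} x∈s with c x∈s y∈s | x ≟ y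
    ... | inj₂ y⊑x | _        = y⊑x
    ... | _        | yes refl = ⊑-refl
    ... | inj₁ x⊑y | no  x≢y  = contradiction (x , x∈s , x⊑y , x≢y) none

    y-minimal : IsMinimal y
    y-minimal z z⊑y = antisym z⊑y
      (y-least (comparable⇒∈ s-max λ x∈s → inj₂ (⊑-trans z⊑y (y-least x∈s))))
  ... | yes (_ , x₀∈s , x₀⊏y) = x , x∈s , ℕ.suc-injective (trans (sym (r-cover x⋖y)) ry≡1+m)
    where
    top = greatest {⟪ below? s y ⟫}
      (λ u∈ v∈ → c (proj₁ (∈⟪⟫⁻ (below? s y) u∈)) (proj₁ (∈⟪⟫⁻ (below? s y) v∈)))
      (∈⟪⟫⁺ (below? s y) (x₀∈s , x₀⊏y))
    x   = proj₁ top
    x∈s = proj₁ (∈⟪⟫⁻ (below? s y) (proj₁ (proj₂ top)))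
    x⊏y = proj₂ (∈⟪⟫⁻ (below? s y) (proj₁ (proj₂ top)))

    x-top : ∀ {u} → u ∈ s → u ⊏ y → u ⊑ x
    x-top u∈s u⊏y = proj₂ (proj₂ top) (∈⟪⟫⁺ (below? s y) (u∈s , u⊏y))

    x⋖y : x ⋖ y
    x⋖y = x⊏y , λ (w , (x⊑w , x≢w) , w⊏y) →
      x≢w (antisym x⊑w (x-top (comparable⇒∈ s-max (comp x⊑w (proj₁ w⊏y))) w⊏y))
      where
      comp : ∀ {w} → x ⊑ w → w ⊑ y → ∀ {u} → u ∈ s → u ⊑ w ⊎ w ⊑ u
      comp x⊑w w⊑y {u} u∈s with c u∈s y∈s | u ≟ y
      ... | inj₂ y⊑u | _        = inj₂ (⊑-trans w⊑y y⊑u)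
      ... | _        | yes refl = inj₂ w⊑y
      ... | inj₁ u⊑y | no  u≢y  = inj₁ (⊑-trans (x-top u∈s (u⊑y , u≢y)) x⊑w)

  ranks-below-attained : ∀ {s y m} → IsMaximalSimplex Δ s → y ∈ s → m ≤ r y →
    ∃[ x ] (x ∈ s × r x ≡ m)
  ranks-below-attained {s} {y} {m} s-max y∈s m≤ry = go (r y ∸ m) y∈s (sym (ℕ.m∸n+n≡m m≤ry))
    where
    go : ∀ d {y} → y ∈ s → r y ≡ d + m → ∃[ x ] (x ∈ s × r x ≡ m)
    go zero    y∈s eq = _ , y∈s , eq
    go (suc d) y∈s eq = let x , x∈s , eq′ = predecessor s-max y∈s eq in go d x∈s eq′

  -- As `r` is injective on chains, this means exactly one element of each rank from `lo` to `hi`.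
  -- Speaking of ranks rather than covers makes cutting to a window immediate.
  record IsSaturated (lo hi : ℕ) (s : Subset N) : Set where
    field
      chain    : IsChain s
      lo≤r     : ∀ {x} → x ∈ s → lo ≤ r x
      r≤hi     : ∀ {x} → x ∈ s → r x ≤ hi
      attained : ∀ {m} → lo ≤ m → m ≤ hi → ∃[ x ] (x ∈ s × r x ≡ m)

  open IsSaturated

  -- All ranks up to `r x` are attained, so `r x` is less than `∣ s ∣`, which is `suc n`.
  -- Conversely, if no element had rank at least `m`, injectivity of `r` would give `∣ s ∣ ≤ m ≤ n`;
  -- from such an element one descends to rank `m`.
  maximal⇒saturated : ∀ {s} → IsMaximalSimplex Δ s → IsSaturated 0 n s
  maximal⇒saturated {s} s-max@(c , _) = record
    { chain    = c
    ; lo≤r     = λ _ → z≤n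
    ; r≤hi     = λ {x} x∈s → ℕ.≤-pred (subst (suc (r x) ≤_) (maximal-chain s s-max)
        (attained⇒≤∣∣ r (suc (r x)) λ m<1+rx →
          ranks-below-attained s-max x∈s (ℕ.≤-pred m<1+rx)))
    ; attained = λ _ → att
    }
    where
    att : ∀ {m} → m ≤ n → ∃[ x ] (x ∈ s × r x ≡ m)
    att {m} m≤n with Fin.any? (λ y → (y ∈? s) ×-dec (m ℕ.≤? r y))
    ... | yes (y , y∈s , m≤ry) = ranks-below-attained s-max y∈s m≤ry
    ... | no  none = contradiction
      (subst (_≤ m) (maximal-chain s s-max)
        (injective⇒∣∣≤ r m (r-injective c) λ y∈s → ℕ.≰⇒> λ m≤ry → none (_ , y∈s , m≤ry)))
      (ℕ.<⇒≱ (s≤s m≤n))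

  inWindow? : ∀ s lo hi → Decidable (λ x → x ∈ s × lo ≤ r x × r x ≤ hi)
  inWindow? s lo hi x = (x ∈? s) ×-dec (lo ℕ.≤? r x) ×-dec (r x ℕ.≤? hi)

  window : Subset N → ℕ → ℕ → Subset N
  window s lo hi = ⟪ inWindow? s lo hi ⟫

  module _ {s : Subset N} {lo hi : ℕ} where
    ∈window⁺ : ∀ {x} → x ∈ s → lo ≤ r x → r x ≤ hi → x ∈ window s lo hi
    ∈window⁺ x∈s lo≤ ≤hi = ∈⟪⟫⁺ (inWindow? s lo hi) (x∈s , lo≤ , ≤hi)

    ∈window⁻ : ∀ {x} → x ∈ window s lo hi → x ∈ s × lo ≤ r x × r x ≤ hi
    ∈window⁻ = ∈⟪⟫⁻ (inWindow? s lo hi)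

  window-saturated : ∀ {s lo hi} → IsSaturated 0 n s → hi ≤ n →
    IsSaturated lo hi (window s lo hi)
  window-saturated {s} {lo} {hi} sat hi≤n = record
    { chain    = λ x∈ y∈ → chain sat (proj₁ (∈window⁻ {s} {lo} x∈)) (proj₁ (∈window⁻ {s} {lo} y∈))
    ; lo≤r     = λ x∈ → proj₁ (proj₂ (∈window⁻ x∈))
    ; r≤hi     = λ x∈ → proj₂ (proj₂ (∈window⁻ {s} {lo} x∈))
    ; attained = att
    }
    where
    att : ∀ {m} → lo ≤ m → m ≤ hi → ∃[ x ] (x ∈ window s lo hi × r x ≡ m)
    att lo≤m m≤hi with attained sat z≤n (ℕ.≤-trans m≤hi hi≤n)
    ... | x , x∈s , refl = x , ∈window⁺ x∈s lo≤m m≤hi , refl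

  -- A simplex `t` containing `s` has elements of ranks `lo` and `lo + k`, so the bound `k` on its
  -- span confines it to these ranks. Each element of `t` then shares its rank with one of `s` and
  -- equals it.
  saturated⇒maximal : ∀ {s lo k} → IsSaturated lo (lo + k) s → IsMaximalSimplex Δ⟨ k ⟩ s
  saturated⇒maximal {s} {lo} {k} sat = (chain sat , narrow) , s-max
    where
    narrow : ∀ {x₀ xₗ} → IsLeast s x₀ → IsGreatest s xₗ → r xₗ ∸ r x₀ ≤ k
    narrow (x₀∈s , _) (xₗ∈s , _) = subst (_ ≤_) (ℕ.m+n∸m≡n lo k)
      (ℕ.∸-mono (r≤hi sat xₗ∈s) (lo≤r sat x₀∈s))

    s-max : ∀ t → Simplex Δ⟨ k ⟩ t → s ⊆ t → t ≡ s
    s-max t (c , b) s⊆t = ⊆-antisym t⊆s s⊆t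
      where
      t⊆s : t ⊆ s
      t⊆s {y} y∈t
        with attained sat {lo} ℕ.≤-refl (ℕ.m≤m+n lo k)
           | attained sat {lo + k} (ℕ.m≤m+n lo k) ℕ.≤-refl
           | least c y∈t | greatest c y∈t
      ... | a , a∈s , ra≡lo | z , z∈s , rz≡hi | x₀ , x₀-least | xₗ , xₗ-greatest
        with attained sat {r y} lo≤ry ry≤hi
        where
        rxₗ≤rx₀+k : r xₗ ≤ r x₀ + k
        rxₗ≤rx₀+k = m∸n≤o⇒m≤n+o (r xₗ) (r x₀) (b x₀-least xₗ-greatest)

        -- Here `lo + k` is `r z`, and `r z ≤ r xₗ ≤ r x₀ + k`; cancel `k`.
        lo≤ry : lo ≤ r y
        lo≤ry = ℕ.≤-trans
          (ℕ.+-cancelʳ-≤ k lo (r x₀) (ℕ.≤-trans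
            (subst (_≤ r xₗ) rz≡hi (r-mono (proj₂ xₗ-greatest (s⊆t z∈s)))) rxₗ≤rx₀+k))
          (r-mono (proj₂ x₀-least y∈t))

        ry≤hi : r y ≤ lo + k
        ry≤hi = ℕ.≤-trans (r-mono (proj₂ xₗ-greatest y∈t)) (ℕ.≤-trans rxₗ≤rx₀+k
          (ℕ.+-monoˡ-≤ k (subst (r x₀ ≤_) ra≡lo (r-mono (proj₂ x₀-least (s⊆t a∈s))))))
      ... | y′ , y′∈s , ry′≡ry = subst (_∈ s) (r-injective c (s⊆t y′∈s) y∈t ry′≡ry) y′∈s

  -- Extend `s` to a maximal chain `M`. A window of `M` around `s` is a simplex of `Δ⟨ k ⟩`, so
  -- maximality of `s` makes the two equal.
  maximal⇒window : ∀ {k} → k ≤ n → ∀ {s} → IsMaximalSimplex Δ⟨ k ⟩ s →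
    ∃₂ λ M lo → IsMaximalSimplex Δ M × lo ≤ n ∸ k × window M lo (lo + k) ≡ s
  maximal⇒window {k} k≤n {s} ((c , b) , s-max) with extend-to-maximal Δ isChain? {s} c
  ... | M , M-max , s⊆M = M , lo , M-max , lo≤n∸k ,
        s-max (window M lo (lo + k)) (proj₁ (saturated⇒maximal (window-saturated M-sat hi≤n)))
          (λ x∈s → ∈window⁺ (s⊆M x∈s) (proj₁ (bounds x∈s)) (proj₂ (bounds x∈s)))
    where
    M-sat : IsSaturated 0 n M
    M-sat = maximal⇒saturated M-max

    lowest : ∃[ lo ] (lo ≤ n ∸ k × (∀ {x} → x ∈ s → lo ≤ r x × r x ≤ lo + k))
    lowest with Fin.any? (_∈? s)
    -- The bounds are vacuous for the empty chain.
    ... | no  empty = 0 , z≤n , λ x∈s → contradiction (_ , x∈s) empty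
    ... | yes (_ , x∈s) with least {s} c x∈s | greatest {s} c x∈s
    ...   | x₀ , x₀-least@(_ , lo≤) | xₗ , xₗ-greatest@(_ , ≤hi) =
      -- The least rank in `s` is capped so that the window does not reach past rank `n`. The window
      -- still covers `s`, whose ranks are at most `n`.
      r x₀ ⊓ (n ∸ k) , ℕ.m⊓n≤n (r x₀) _ , λ {y} y∈s →
        ℕ.≤-trans (ℕ.m⊓n≤m (r x₀) _) (r-mono (lo≤ y∈s)) ,
        subst (r y ≤_) (sym (ℕ.+-distribʳ-⊓ k (r x₀) (n ∸ k)))
          (ℕ.⊓-glb
            (ℕ.≤-trans (r-mono (≤hi y∈s))
              (m∸n≤o⇒m≤n+o (r xₗ) (r x₀) (b x₀-least xₗ-greatest)))
            (subst (r y ≤_) (sym (ℕ.m∸n+n≡m k≤n)) (r≤hi M-sat (s⊆M y∈s))))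

    lo     = proj₁ lowest
    lo≤n∸k = proj₁ (proj₂ lowest)
    hi≤n   = ℕ.≤-trans (ℕ.+-monoˡ-≤ k lo≤n∸k) (ℕ.≤-reflexive (ℕ.m∸n+n≡m k≤n))

    bounds : ∀ {x} → x ∈ s → lo ≤ r x × r x ≤ lo + k
    bounds = proj₂ (proj₂ lowest)

  -- The shelling of Δ⟨ k ⟩

  module Windows {k} (k≤n : k ≤ n) {t} (F : Fin t → Subset N) (shelling : IsShelling Δ t F) where

    F-max : ∀ j → IsMaximalSimplex Δ (F j)
    F-max j = Equivalence.from (proj₁ (proj₂ shelling) (F j)) (j , refl)

    F-exchange : ∀ {i j} → i < j → Exchange F i j
    F-exchange {i} {j} i<j =
      pure⇒exchange F (proj₂ (proj₂ shelling) j (ℕ.≤-<-trans z≤n i<j)) i<j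

    facet : Fin (suc (n ∸ k)) → Fin t → Subset N
    facet a j = window (F j) (toℕ a) (toℕ a + k)

    facet-saturated : ∀ a j → IsSaturated (toℕ a) (toℕ a + k) (facet a j)
    facet-saturated a j = window-saturated (maximal⇒saturated (F-max j))
      (ℕ.≤-trans (ℕ.+-monoˡ-≤ k (Fin.toℕ≤pred[n] a)) (ℕ.≤-reflexive (ℕ.m∸n+n≡m k≤n)))

    -- `Fin.remQuot` inverts `combine`, so comparing indices compares pairs lexicographically,
    -- window bottom first.
    index : Fin (suc (n ∸ k) ℕ.* t) → Fin (suc (n ∸ k)) × Fin t
    index = Fin.remQuot t

    G : Fin (suc (n ∸ k) ℕ.* t) → Subset N
    G i = facet (proj₁ (index i)) (proj₂ (index i))

    G-combine : ∀ a j → G (combine a j) ≡ facet a j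
    G-combine a j = cong (λ (a , j) → facet a j) (Fin.remQuot-combine a j)

    G-facets : ∀ s → IsMaximalSimplex Δ⟨ k ⟩ s ⇔ (∃[ i ] G i ≡ s)
    G-facets s = mk⇔ to from
      where
      to : IsMaximalSimplex Δ⟨ k ⟩ s → ∃[ i ] G i ≡ s
      to s-max with maximal⇒window k≤n s-max
      ... | M , lo , M-max , lo≤n∸k , refl with Equivalence.to (proj₁ (proj₂ shelling) M) M-max
      ...   | j , refl = combine (fromℕ< (s≤s lo≤n∸k)) j ,
              trans (G-combine _ j)
                (cong (λ lo → window (F j) lo (lo + k)) (Fin.toℕ-fromℕ< (s≤s lo≤n∸k)))

      from : ∃[ i ] G i ≡ s → IsMaximalSimplex Δ⟨ k ⟩ s
      from (i , refl) = saturated⇒maximal (facet-saturated (proj₁ (index i)) (proj₂ (index i)))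

    -- The shelling of `Δ` exchanges some `x` of `F j`. If `x` lies in the window, the exchange
    -- restricts to it.
    facet-step : ∀ a j {i} → i < j →
      (∃[ l ] (l < j × facet a l ≡ facet a j)) ⊎ Exchange (facet a) i j
    facet-step a j {i} i<j with F-exchange i<j
    ... | x , l , x∈Fj , x∉Fi , l<j , Fj-x⊆Fl with x ∈? facet a j
    ...   | yes x∈ = inj₂ (x , l , x∈ , x∉Fi ∘ proj₁ ∘ ∈window⁻ {F i} {toℕ a} , l<j , sub)
      where
      sub : facet a j - x ⊆ facet a l
      sub {y} y∈ with ∈window⁻ {F j} {toℕ a} (p-x⊆p (facet a j) y∈)
      ... | y∈Fj , lo≤ , ≤hi = ∈window⁺
        (Fj-x⊆Fl (x∈p∧x≢y⇒x∈p-y y∈Fj λ { refl → x∉p-x {p = facet a j} y∈ })) lo≤ ≤hi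
    -- With `x` outside the window, `F j - x ⊆ F l` yields `facet a j ⊆ facet a l`, and maximality
    -- turns this into equality.
    ...   | no x∉ = inj₁ (l , l<j ,
              proj₂ (saturated⇒maximal (facet-saturated a j)) (facet a l)
                (proj₁ (saturated⇒maximal (facet-saturated a l))) sub)
      where
      sub : facet a j ⊆ facet a l
      sub {y} y∈ with ∈window⁻ {F j} {toℕ a} y∈
      ... | y∈Fj , lo≤ , ≤hi = ∈window⁺
        (Fj-x⊆Fl (x∈p∧x≢y⇒x∈p-y y∈Fj λ { refl → x∉ y∈ })) lo≤ ≤hi

    -- The top element `x` outranks everything in a lower window. The remaining ranks fit the window
    -- one step down on the same chain, so `b` is the predecessor of `a`.
    window-step : ∀ a j {a′ j′} → a′ < a →
      ∃₂ λ x b → x ∈ facet a j × x ∉ facet a′ j′ × b < a × facet a j - x ⊆ facet b j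
    window-step (suc a) j {a′} {j′} a′<1+a
      with attained (facet-saturated (suc a) j) {suc (toℕ a) + k} (ℕ.m≤m+n _ k) ℕ.≤-refl
    ... | x , x∈ , rx≡hi = x , Fin.inject₁ a , x∈ , x∉ , Fin.≤̄⇒inject₁< ℕ.≤-refl , sub
      where
      x∉ : x ∉ facet a′ j′
      x∉ x∈′ = ℕ.<⇒≱ (ℕ.+-monoˡ-< k a′<1+a)
        (subst (_≤ toℕ a′ + k) rx≡hi (r≤hi (facet-saturated a′ j′) x∈′))

      sub : facet (suc a) j - x ⊆ facet (Fin.inject₁ a) j
      sub {y} y∈ with p-x⊆p (facet (suc a) j) y∈
      ... | y∈′ with ∈window⁻ {F j} y∈′
      -- An element of top rank would be the deleted `x`, so the upper bound drops by one; the lower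
      -- bound merely relaxes.
      ...   | y∈Fj , lo≤ , ≤hi = subst (λ b → y ∈ window (F j) b (b + k)) (sym (Fin.toℕ-inject₁ a))
              (∈window⁺ y∈Fj (ℕ.<⇒≤ lo≤) (ℕ.≤-pred (ℕ.≤∧≢⇒< ≤hi ry≢hi)))
        where
        ry≢hi : r y ≢ suc (toℕ a) + k
        ry≢hi ry≡hi = x∉p-x {p = facet (suc a) j} (subst (_∈ facet (suc a) j - x)
          (r-injective (chain (facet-saturated (suc a) j)) y∈′ x∈ (trans ry≡hi (sym rx≡hi))) y∈)

    combine-mono : ∀ (a : Fin (suc (n ∸ k))) {i j : Fin t} → i < j → combine a i < combine a j
    combine-mono a {i} {j} i<j = subst₂ ℕ._<_ (sym (Fin.toℕ-combine a i)) (sym (Fin.toℕ-combine a j))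
      (ℕ.+-monoʳ-< (t ℕ.* toℕ a) i<j)

    -- A lower bottom is handled by `window-step`, an equal one by `facet-step`; all other
    -- comparisons contradict the lexicographic order.
    combine-exchange : ∀ (a′ : Fin (suc (n ∸ k))) j′ a j → combine a′ j′ < combine a j →
      Repeated G (combine a j) ⊎ Exchange G (combine a′ j′) (combine a j)
    combine-exchange a′ j′ a j lt with Fin.<-cmp a′ a
    ... | tri> _ _ a<a′ = contradiction lt (ℕ.<-asym (Fin.combine-monoˡ-< j j′ a<a′))
    ... | tri< a′<a _ _ with window-step a j {a′} {j′} a′<a
    ...   | x , b , x∈ , x∉ , b<a , sub rewrite G-combine a j | G-combine a′ j′ =
      inj₂ (x , combine b j , x∈ , x∉ , Fin.combine-monoˡ-< j j b<a ,
        λ {y} y∈ → subst (y ∈_) (sym (G-combine b j)) (sub y∈))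
    combine-exchange a′ j′ a j lt | tri≈ _ refl _ with Fin.<-cmp j′ j
    ...   | tri≈ _ refl _ = contradiction lt (ℕ.<-irrefl refl)
    ...   | tri> _ _ j<j′ = contradiction lt (ℕ.<-asym (combine-mono a j<j′))
    ...   | tri< j′<j _ _ with facet-step a j j′<j
    ...     | inj₁ (l , l<j , eq) = inj₁ (combine a l , combine-mono a l<j ,
                trans (G-combine a l) (trans eq (sym (G-combine a j))))
    ...     | inj₂ (x , l , x∈ , x∉ , l<j , sub) rewrite G-combine a j | G-combine a′ j′ =
      inj₂ (x , combine a l , x∈ , x∉ , combine-mono a l<j ,
        λ {y} y∈ → subst (y ∈_) (sym (G-combine a l)) (sub y∈))

    G-exchange : ∀ {i j} → i < j → Repeated G j ⊎ Exchange G i j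
    G-exchange {i} {j} i<j
      with Fin.combine-surjective {suc (n ∸ k)} {t} i | Fin.combine-surjective {suc (n ∸ k)} {t} j
    ... | a′ , j′ , refl | a , j , refl = combine-exchange a′ j′ a j i<j

theorem4p5 : ∀ {N n : ℕ} (P : GradedPoset N n) →
    Shellable (GradedPoset.Δ P) →
    ∀ (k : ℕ) → k ≤ n → Shellable (GradedPoset.Δ⟨_⟩ P k)
theorem4p5 P (t , F , shelling) k k≤n =
  exchange⇒shellable G (GradedPoset.Δ⟨_⟩ P k) G-facets G-exchange
  where open Windows P k≤n F shelling
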